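{- Using the tableau of named MacMahon cubes described in the context: select a set $P$ of exactly three column letters from $\{a,b,c,d,e,f\}$, and then select four rows such that exactly two of the selected row letters correspond (as uppercase versions) to letters in $P$ and the other two do not. The tableau positions lying in neither a selected row nor a selected column consist of five cubes and one empty diagonal position; call these five cubes the targets. The tableau positions lying in both a selected row and a selected column contain exactly $10$ cubes, exactly two of which are mirror cubes of targets; let $W$ be the remaining $8$ cubes. Then $W$ has positive solution number for each of the five targets. The same conclusion holds for the analogous construction with the roles of rows and columns interchanged (select three row letters, then four columns of which exactly two correspond to selected rows and two do not).
   Context: A MacMahon cube is a cube whose six faces are painted with the colors $1,\dots,6$, each used once, up to rotation (there are $30$ of them). At each vertex three faces meet; reading their colors clockwise as seen from outside gives a cyclic triple, and the corner number of the vertex is the cyclic rotation of this triple of smallest three-digit value; a MacMahon cube is determined by its set of $8$ corner numbers. The $30$ MacMahon cubes are named $Xy$ with row letter $X\in\{A,\dots,F\}$ and column letter $y\in\{a,\dots,f\}$, $y$ not the lowercase of $X$ (the diagonal positions $Aa,Bb,\dots,Ff$ of the $6\times6$ tableau are empty); row $X$ consists of cubes $Xy$, column $y$ of cubes $Xy$; row letter $X$ and column letter $x$ correspond. The mirror cube of $Xy$ is $Yx$. Corner numbers: Ab $\{143,345,235,132,126,256,465,164\}$; Ac $\{153,134,142,125,265,246,364,356\}$; Ad $\{243,123,152,254,456,165,136,346\}$; Ae $\{354,145,124,234,263,162,156,365\}$; Af $\{245,154,135,253,236,163,146,264\}$; Ba $\{123,253,354,134,146,456,265,162\}$; Bc $\{143,154,245,234,263,256,165,136\}$;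 Bd $\{153,132,124,145,465,264,236,356\}$; Be $\{152,135,345,254,246,364,163,126\}$; Bf $\{243,235,125,142,164,156,365,346\}$; Ca $\{152,124,143,135,365,346,264,256\}$; Cb $\{243,254,145,134,163,156,265,236\}$; Cd $\{235,345,154,125,162,146,364,263\}$; Ce $\{245,253,123,142,164,136,356,465\}$; Cf $\{153,354,234,132,126,246,456,165\}$; Da $\{245,125,132,234,364,163,156,465\}$; Db $\{154,142,123,135,365,263,246,456\}$; Dc $\{152,145,354,253,236,346,164,126\}$; De $\{153,235,243,134,146,264,256,165\}$; Df $\{143,124,254,345,356,265,162,136\}$; Ea $\{243,142,154,345,356,165,126,236\}$; Eb $\{245,354,153,125,162,136,346,264\}$; Ec $\{124,132,235,254,456,365,163,146\}$; Ed $\{143,234,253,135,156,265,246,164\}$; Ef $\{152,123,134,145,465,364,263,256\}$; Fa $\{235,153,145,254,246,164,136,263\}$; Fb $\{124,152,253,234,364,356,165,146\}$; Fc $\{123,243,345,135,156,465,264,162\}$; Fd $\{354,245,142,134,163,126,256,365\}$; Fe $\{154,143,132,125,265,236,346,456\}$. For a target MacMahon cube $T$ and a set $W$ of eight distinct MacMahon cubes, a solution is a bijection $\sigma$ from $W$ to the corner numbers of $T$ with $\sigma(C)$ a corner number of $C$ for every $C\in W$ (an arrangement of the cubes into a $2\times2\times2$ block whose exterior is colored like an enlarged $T$, no condition on interior faces); the solution number is the number of solutions. -}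

module Defs where

open import Data.Bool using (Bool; true; false; if_then_else_; _∧_; not)
open import Data.Nat using (ℕ; _≡ᵇ_)
open import Data.Fin using (Fin; toℕ)
open import Data.Fin.Subset using (Subset; ∣_∣; _∩_)
open import Data.List using (List; []; _∷_; map; filterᵇ; allFin; concatMap; length)
open import Data.Bool.ListAction using (any)
open import Data.Nat.ListAction using (sum)
open import Data.Product using (_×_; _,_; proj₁; proj₂)
open import Data.Vec using (Vec; lookup) renaming ([] to []ᵛ; _∷_ to _∷ᵛ_)

-- Letters a..f / A..F are indices 0..5 of Fin 6; row letter X and column letter x
-- share the same index.  A tableau position is (row , column).
Pos : Set
Pos = Fin 6 × Fin 6

_≡ᶠ_ : Fin 6 → Fin 6 → Bool
i ≡ᶠ j = toℕ i ≡ᵇ toℕ j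

isCube : Pos → Bool
isCube (i , j) = not (i ≡ᶠ j)

mirror : Pos → Pos
mirror (i , j) = (j , i)

_≡ᵖ_ : Pos → Pos → Bool
(i , j) ≡ᵖ (k , l) = (i ≡ᶠ k) ∧ (j ≡ᶠ l)

-- the corner numbers (table from the context); diagonal entries are empty
cornerTable : Vec (Vec (List ℕ) 6) 6
cornerTable =
  ( []
  ∷ᵛ (143 ∷ 345 ∷ 235 ∷ 132 ∷ 126 ∷ 256 ∷ 465 ∷ 164 ∷ [])
  ∷ᵛ (153 ∷ 134 ∷ 142 ∷ 125 ∷ 265 ∷ 246 ∷ 364 ∷ 356 ∷ [])
  ∷ᵛ (243 ∷ 123 ∷ 152 ∷ 254 ∷ 456 ∷ 165 ∷ 136 ∷ 346 ∷ [])
  ∷ᵛ (354 ∷ 145 ∷ 124 ∷ 234 ∷ 263 ∷ 162 ∷ 156 ∷ 365 ∷ [])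
  ∷ᵛ (245 ∷ 154 ∷ 135 ∷ 253 ∷ 236 ∷ 163 ∷ 146 ∷ 264 ∷ [])
  ∷ᵛ []ᵛ)
  ∷ᵛ ( (123 ∷ 253 ∷ 354 ∷ 134 ∷ 146 ∷ 456 ∷ 265 ∷ 162 ∷ [])
  ∷ᵛ []
  ∷ᵛ (143 ∷ 154 ∷ 245 ∷ 234 ∷ 263 ∷ 256 ∷ 165 ∷ 136 ∷ [])
  ∷ᵛ (153 ∷ 132 ∷ 124 ∷ 145 ∷ 465 ∷ 264 ∷ 236 ∷ 356 ∷ [])
  ∷ᵛ (152 ∷ 135 ∷ 345 ∷ 254 ∷ 246 ∷ 364 ∷ 163 ∷ 126 ∷ [])
  ∷ᵛ (243 ∷ 235 ∷ 125 ∷ 142 ∷ 164 ∷ 156 ∷ 365 ∷ 346 ∷ [])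
  ∷ᵛ []ᵛ)
  ∷ᵛ ( (152 ∷ 124 ∷ 143 ∷ 135 ∷ 365 ∷ 346 ∷ 264 ∷ 256 ∷ [])
  ∷ᵛ (243 ∷ 254 ∷ 145 ∷ 134 ∷ 163 ∷ 156 ∷ 265 ∷ 236 ∷ [])
  ∷ᵛ []
  ∷ᵛ (235 ∷ 345 ∷ 154 ∷ 125 ∷ 162 ∷ 146 ∷ 364 ∷ 263 ∷ [])
  ∷ᵛ (245 ∷ 253 ∷ 123 ∷ 142 ∷ 164 ∷ 136 ∷ 356 ∷ 465 ∷ [])
  ∷ᵛ (153 ∷ 354 ∷ 234 ∷ 132 ∷ 126 ∷ 246 ∷ 456 ∷ 165 ∷ [])
  ∷ᵛ []ᵛ)
  ∷ᵛ ( (245 ∷ 125 ∷ 132 ∷ 234 ∷ 364 ∷ 163 ∷ 156 ∷ 465 ∷ [])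
  ∷ᵛ (154 ∷ 142 ∷ 123 ∷ 135 ∷ 365 ∷ 263 ∷ 246 ∷ 456 ∷ [])
  ∷ᵛ (152 ∷ 145 ∷ 354 ∷ 253 ∷ 236 ∷ 346 ∷ 164 ∷ 126 ∷ [])
  ∷ᵛ []
  ∷ᵛ (153 ∷ 235 ∷ 243 ∷ 134 ∷ 146 ∷ 264 ∷ 256 ∷ 165 ∷ [])
  ∷ᵛ (143 ∷ 124 ∷ 254 ∷ 345 ∷ 356 ∷ 265 ∷ 162 ∷ 136 ∷ [])
  ∷ᵛ []ᵛ)
  ∷ᵛ ( (243 ∷ 142 ∷ 154 ∷ 345 ∷ 356 ∷ 165 ∷ 126 ∷ 236 ∷ [])
  ∷ᵛ (245 ∷ 354 ∷ 153 ∷ 125 ∷ 162 ∷ 136 ∷ 346 ∷ 264 ∷ [])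
  ∷ᵛ (124 ∷ 132 ∷ 235 ∷ 254 ∷ 456 ∷ 365 ∷ 163 ∷ 146 ∷ [])
  ∷ᵛ (143 ∷ 234 ∷ 253 ∷ 135 ∷ 156 ∷ 265 ∷ 246 ∷ 164 ∷ [])
  ∷ᵛ []
  ∷ᵛ (152 ∷ 123 ∷ 134 ∷ 145 ∷ 465 ∷ 364 ∷ 263 ∷ 256 ∷ [])
  ∷ᵛ []ᵛ)
  ∷ᵛ ( (235 ∷ 153 ∷ 145 ∷ 254 ∷ 246 ∷ 164 ∷ 136 ∷ 263 ∷ [])
  ∷ᵛ (124 ∷ 152 ∷ 253 ∷ 234 ∷ 364 ∷ 356 ∷ 165 ∷ 146 ∷ [])
  ∷ᵛ (123 ∷ 243 ∷ 345 ∷ 135 ∷ 156 ∷ 465 ∷ 264 ∷ 162 ∷ [])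
  ∷ᵛ (354 ∷ 245 ∷ 142 ∷ 134 ∷ 163 ∷ 126 ∷ 256 ∷ 365 ∷ [])
  ∷ᵛ (154 ∷ 143 ∷ 132 ∷ 125 ∷ 265 ∷ 236 ∷ 346 ∷ 456 ∷ [])
  ∷ᵛ []
  ∷ᵛ []ᵛ)
  ∷ᵛ []ᵛ

corners : Pos → List ℕ
corners (i , j) = lookup (lookup cornerTable i) j

_∈ᴺ_ : ℕ → List ℕ → Bool
x ∈ᴺ xs = any (x ≡ᵇ_) xs

picks : List ℕ → List (ℕ × List ℕ)
picks [] = []
picks (x ∷ xs) = (x , xs) ∷ map (λ p → proj₁ p , x ∷ proj₂ p) (picks xs)

assignCount : List Pos → List ℕ → ℕ
assignCount [] rem = 1
assignCount (c ∷ cs) rem =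
  sum (map (λ p → if proj₁ p ∈ᴺ corners c then assignCount cs (proj₂ p) else 0) (picks rem))

-- solution number of the set W (listed without repetition) for target T:
-- when W has 8 cubes this counts the bijections W → corners T with
-- σ(C) a corner number of C.
solutionNumber : List Pos → Pos → ℕ
solutionNumber W T = assignCount W (corners T)

allPos : List Pos
allPos = concatMap (λ i → map (λ j → (i , j)) (allFin 6)) (allFin 6)

outside : Subset 6 → Subset 6 → List Pos
outside R K = filterᵇ (λ p → not (lookup R (proj₁ p)) ∧ not (lookup K (proj₂ p))) allPos

targets : Subset 6 → Subset 6 → List Pos
targets R K = filterᵇ isCube (outside R K)

inner : Subset 6 → Subset 6 → List Pos
inner R K = filterᵇ (λ p → lookup R (proj₁ p) ∧ lookup K (proj₂ p) ∧ isCube p) allPos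

isMirrorOfTarget : Subset 6 → Subset 6 → Pos → Bool
isMirrorOfTarget R K p = any (λ t → mirror t ≡ᵖ p) (targets R K)

W : Subset 6 → Subset 6 → List Pos
W R K = filterᵇ (λ p → not (isMirrorOfTarget R K p)) (inner R K)

{-# OPTIONS --safe #-}
-- The claim concerns finitely many pairs (P , S), so it is decided by evaluation.
-- Evaluating solution numbers would mean enumerating every solution; instead the
-- first solution found by backtracking certifies that the number is positive.
module Submission where

open import Defs
open import Data.Nat using (ℕ; _<_)
open import Data.Fin.Subset using (Subset; ∣_∣; _∩_)
open import Data.List using (length; filterᵇ)
open import Data.List.Relation.Unary.All using (All)
open import Data.Product using (_×_)
open import Relation.Binary.PropositionalEquality using (_≡_)

open import Data.Bool using (Bool; true; false; if_then_else_; _∧_; T)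
open import Data.Bool.ListAction using (any)
open import Data.Bool.Properties using (T?)
open import Data.List using (List; []; _∷_; map)
import Data.List.Relation.Unary.All as All
open import Data.Nat using (zero; suc; z<s; _≟_)
open import Data.Nat.ListAction using (sum)
open import Data.Nat.Properties using (<-≤-trans; m≤m+n; m≤n+m)
open import Data.Product using (_,_; proj₁; proj₂)
import Data.Vec as Vec
open import Function using (_∘_; _$_)
open import Level using (Level)
open import Relation.Nullary.Decidable using (Dec; map′; toWitness; _×-dec_; _→-dec_)
open import Relation.Unary using (Pred; Decidable)

private
  variable
    a ℓ : Level
    A : Set a
    n : ℕ

-- The summand at the first entry passing `p` is positive, and natural summands cannot cancel it.
sum-map-positive : (p : A → Bool) (g : A → ℕ) → (∀ x → T (p x) → 0 < g x) →
  ∀ xs → T (any p xs) → 0 < sum (map g xs)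
-- Abstracting `pos x` along with `p x` lets its premise `T (p x)` reduce to the unit type in the
-- first branch.
sum-map-positive p g pos (x ∷ xs) h with p x | pos x
... | true  | gx>0 = <-≤-trans (gx>0 _) (m≤m+n (g x) _)
... | false | _    = <-≤-trans (sum-map-positive p g pos xs h) (m≤n+m _ (g x))

if-positive : ∀ b c {k} → (T c → 0 < k) → T (b ∧ c) → 0 < (if b then k else 0)
if-positive true c pos h = pos h

-- Follows the recursion of `assignCount` with `any` for `sum` and `∧` for the conditional, so lazy
-- evaluation can stop early.
solvable : List Pos → List ℕ → Bool
solvable []       rem = true
solvable (c ∷ cs) rem =
  any (λ p → (proj₁ p ∈ᴺ corners c) ∧ solvable cs (proj₂ p)) (picks rem)

-- Both recursions branch over the same `picks rem`, so a successful branch of the search is a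
-- positive summand of the count.
assignCount-positive : ∀ cs rem → T (solvable cs rem) → 0 < assignCount cs rem
assignCount-positive []       rem _ = z<s
assignCount-positive (c ∷ cs) rem =
  sum-map-positive _ _
    (λ p → if-positive (proj₁ p ∈ᴺ corners c) _ (assignCount-positive cs (proj₂ p)))
    (picks rem)

allSubsets? : {Q : Pred (Subset n) ℓ} → Decidable Q → Dec (∀ s → Q s)
allSubsets? {n = zero}  Q? = map′ (λ { q Vec.[] → q }) (_$ Vec.[]) (Q? Vec.[])
allSubsets? {n = suc n} Q? =
  map′ (λ { (i , o) (true Vec.∷ s) → i s ; (i , o) (false Vec.∷ s) → o s })
       (λ q → q ∘ (true Vec.∷_) , q ∘ (false Vec.∷_))
       (allSubsets? (Q? ∘ (true Vec.∷_)) ×-dec allSubsets? (Q? ∘ (false Vec.∷_)))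

-- Abstract in `Solves` so that the cheap criterion can be decided and then exchanged for the
-- solution number.
Conclusion : (Pos → List Pos → Set) → Subset 6 → Subset 6 → Set
Conclusion Solves R K =
  length (outside R K) ≡ 6 × length (targets R K) ≡ 5
  × length (inner R K) ≡ 10 × length (filterᵇ (isMirrorOfTarget R K) (inner R K)) ≡ 2
  × All (λ t → Solves t (W R K)) (targets R K)

HasSolution HasPositiveNumber : Pos → List Pos → Set
HasSolution       t ws = T (solvable ws (corners t))
HasPositiveNumber t ws = 0 < solutionNumber ws t

conclusion? : ∀ R K → Dec (Conclusion HasSolution R K)
conclusion? R K =
  (_ ≟ _) ×-dec (_ ≟ _) ×-dec (_ ≟ _) ×-dec (_ ≟ _)
  ×-dec All.all? (λ _ → T? _) (targets R K)

conclusion-positive : ∀ R K → Conclusion HasSolution R K → Conclusion HasPositiveNumber R K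
conclusion-positive R K (o , t , i , m , sol) =
  o , t , i , m , All.map (assignCount-positive (W R K) _) sol

allConclusions? : Dec (∀ (P S : Subset 6) → ∣ P ∣ ≡ 3 → ∣ S ∣ ≡ 4 → ∣ S ∩ P ∣ ≡ 2 →
  Conclusion HasSolution S P × Conclusion HasSolution P S)
-- A failed cardinality test settles the implication at once, so only 180 of the 4096 pairs reach
-- the search.
allConclusions? = allSubsets? λ P → allSubsets? λ S →
  (∣ P ∣ ≟ 3) →-dec (∣ S ∣ ≟ 4) →-dec (∣ S ∩ P ∣ ≟ 2) →-dec
  (conclusion? S P ×-dec conclusion? P S)

theorem15 : (P S : Subset 6) → ∣ P ∣ ≡ 3 → ∣ S ∣ ≡ 4 → ∣ S ∩ P ∣ ≡ 2 →
    ((length (outside S P) ≡ 6 × length (targets S P) ≡ 5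
    × length (inner S P) ≡ 10 × length (filterᵇ (isMirrorOfTarget S P) (inner S P)) ≡ 2
    × All (λ T → 0 < solutionNumber (W S P) T) (targets S P))
    × (length (outside P S) ≡ 6 × length (targets P S) ≡ 5
    × length (inner P S) ≡ 10 × length (filterᵇ (isMirrorOfTarget P S) (inner P S)) ≡ 2
    × All (λ T → 0 < solutionNumber (W P S) T) (targets P S)))
theorem15 P S p s sp =
  -- The `_` has a type that reduces to the unit type once the whole search has been evaluated
  -- during type checking.
  let cols , rows = toWitness {a? = allConclusions?} _ P S p s sp
  in conclusion-positive S P cols , conclusion-positive P S rows
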